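{- If $\mathbf{A}=\langle A;\land,\lor,\to,\sim,',1\rangle$ is a dually hemimorphic semi-Nelson algebra, then $\mathbf{A}$ is centered, with center $1'$; that is, $\sim(1')=1'$.
   Context: **Semi-Nelson algebra**: an algebra $\mathbf{A}=\langle A;\land,\lor,\to,\sim,1\rangle$ of type $(2,2,2,1,0)$ such that, writing $x\to_N y:=x\to(x\land y)$, for all $x,y,z\in A$: (SN1) $x\land(x\lor y)=x$; (SN2) $x\land(y\lor z)=(z\land x)\lor(y\land x)$; (SN3) $\sim\sim x=x$; (SN4) $\sim(x\land y)=\sim x\lor\sim y$; (SN5) $x\land\sim x=(x\land\sim x)\land(y\lor\sim y)$; (SN6) $x\land(x\to_N y)=x\land(\sim x\lor y)$; (SN7) $x\to_N(y\to_N z)=(x\land y)\to_N z$; (SN8) $(x\to_N y)\to_N[(y\to_N x)\to_N[(x\to z)\to_N(y\to z)]]=1$; (SN9) $(x\to_N y)\to_N[(y\to_N x)\to_N[(z\to x)\to_N(z\to y)]]=1$; (SN10) $(\sim(x\to y))\to_N(x\land\sim y)=1$; (SN11) $(x\land\sim y)\to_N(\sim(x\to y))=1$. **Dually hemimorphic semi-Nelson algebra**: an algebra $\langle A;\land,\lor,\to,\sim,',1\rangle$ of type $(2,2,2,1,1,0)$ such that $\langle A;\land,\lor,\to,\sim,1\rangle$ is a semi-Nelson algebra and for all $x,y\in A$ (with $\sim x'$ meaning $\sim(x')$): (DSN1) $(\sim 1)'=1$; (DSN2) $1'\to(\sim 1)=1$; (DSN3) $((x\to y)\land(y\to x)\land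 x')\to_N((x\to y)\land(y\to x)\land y)'=1$; (DSN4) $\sim x'\to(\sim x\land(x'\to x))=1$; (DSN5) $(\sim x\land(x'\to x))\to\sim x'=1$; (DSN6) $(x\land y)'\to(x'\lor y')=1$; (DSN7) $(x'\lor y')\to(x\land y)'=1$. A semi-Nelson algebra is **centered** if it has an element $c$ with $\sim c=c$; such a $c$ is called a center (it is necessarily unique). -}

module Defs where

open import Level using (Level; _⊔_; suc)
open import Algebra.Core using (Op₁; Op₂)
open import Algebra.Definitions using (Congruent₁; Congruent₂)
open import Data.Product using (∃)
open import Relation.Binary.Core using (Rel)
open import Relation.Binary.Structures using (IsEquivalence)

-- As in the standard library's algebraic hierarchy, equations are stated in a
-- setoid equality _≈_ respected by every operation; algebras on a plain set are
-- the instances in which _≈_ is _≡_.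

record SemiNelsonAlgebra (a ℓ : Level) : Set (suc (a ⊔ ℓ)) where
  infix  9 ∼_
  infixr 7 _∧_
  infixr 6 _∨_
  infixr 5 _⇒_ _⇒N_
  infix  4 _≈_
  field
    Carrier : Set a
    _≈_     : Rel Carrier ℓ
    _∧_     : Op₂ Carrier
    _∨_     : Op₂ Carrier
    _⇒_     : Op₂ Carrier
    ∼_      : Op₁ Carrier
    𝟏       : Carrier

    isEquivalence : IsEquivalence _≈_
    ∧-cong        : Congruent₂ _≈_ _∧_
    ∨-cong        : Congruent₂ _≈_ _∨_
    ⇒-cong        : Congruent₂ _≈_ _⇒_
    ∼-cong        : Congruent₁ _≈_ ∼_

  _⇒N_ : Op₂ Carrier
  x ⇒N y = x ⇒ (x ∧ y)

  field
    SN1  : ∀ x y → x ∧ (x ∨ y) ≈ x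
    SN2  : ∀ x y z → x ∧ (y ∨ z) ≈ (z ∧ x) ∨ (y ∧ x)
    SN3  : ∀ x → ∼ (∼ x) ≈ x
    SN4  : ∀ x y → ∼ (x ∧ y) ≈ (∼ x) ∨ (∼ y)
    SN5  : ∀ x y → x ∧ (∼ x) ≈ (x ∧ (∼ x)) ∧ (y ∨ (∼ y))
    SN6  : ∀ x y → x ∧ (x ⇒N y) ≈ x ∧ ((∼ x) ∨ y)
    SN7  : ∀ x y z → x ⇒N (y ⇒N z) ≈ (x ∧ y) ⇒N z
    SN8  : ∀ x y z → (x ⇒N y) ⇒N ((y ⇒N x) ⇒N ((x ⇒ z) ⇒N (y ⇒ z))) ≈ 𝟏
    SN9  : ∀ x y z → (x ⇒N y) ⇒N ((y ⇒N x) ⇒N ((z ⇒ x) ⇒N (z ⇒ y))) ≈ 𝟏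
    SN10 : ∀ x y → (∼ (x ⇒ y)) ⇒N (x ∧ (∼ y)) ≈ 𝟏
    SN11 : ∀ x y → (x ∧ (∼ y)) ⇒N (∼ (x ⇒ y)) ≈ 𝟏

  IsCenter : Carrier → Set ℓ
  IsCenter c = ∼ c ≈ c

  Centered : Set (a ⊔ ℓ)
  Centered = ∃ IsCenter

record DuallyHemimorphicSemiNelsonAlgebra (a ℓ : Level) : Set (suc (a ⊔ ℓ)) where
  infix 10 _′
  field
    semiNelsonAlgebra : SemiNelsonAlgebra a ℓ

  open SemiNelsonAlgebra semiNelsonAlgebra public

  field
    _′     : Op₁ Carrier
    ′-cong : Congruent₁ _≈_ _′

    DSN1 : (∼ 𝟏) ′ ≈ 𝟏
    DSN2 : (𝟏 ′) ⇒ (∼ 𝟏) ≈ 𝟏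
    DSN3 : ∀ x y → (((x ⇒ y) ∧ (y ⇒ x)) ∧ (x ′)) ⇒N ((((x ⇒ y) ∧ (y ⇒ x)) ∧ y) ′) ≈ 𝟏
    DSN4 : ∀ x → (∼ (x ′)) ⇒ ((∼ x) ∧ ((x ′) ⇒ x)) ≈ 𝟏
    DSN5 : ∀ x → ((∼ x) ∧ ((x ′) ⇒ x)) ⇒ (∼ (x ′)) ≈ 𝟏
    DSN6 : ∀ x y → ((x ∧ y) ′) ⇒ ((x ′) ∨ (y ′)) ≈ 𝟏
    DSN7 : ∀ x y → ((x ′) ∨ (y ′)) ⇒ ((x ∧ y) ′) ≈ 𝟏

{-# OPTIONS --safe #-}
-- SN6 with y = ∼ 𝟏 shows that x ⇒ ∼ 𝟏 ≈ 𝟏 forces x ≤ ∼ x.  DSN2 provides this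
-- hypothesis for x = 𝟏 ′, and DSN4 at 𝟏 provides it for x = ∼ (𝟏 ′), because ∼ 𝟏
-- is the least element; hence 𝟏 ′ ≤ ∼ (𝟏 ′) ≤ 𝟏 ′.
module Submission where

open import Defs
open import Level using (Level)
open import Data.Product using (_×_; _,_)
open import Algebra.Definitions using (Commutative; Idempotent; LeftZero; RightIdentity)
open import Relation.Binary.Bundles using (Setoid)
open import Relation.Binary.Structures using (IsEquivalence)
import Relation.Binary.Reasoning.Setoid as SetoidReasoning

module SemiNelsonProperties {a ℓ : Level} (S : SemiNelsonAlgebra a ℓ) where
  open SemiNelsonAlgebra S
  open IsEquivalence isEquivalence public using (refl; sym; trans)

  setoid : Setoid a ℓ
  setoid = record { isEquivalence = isEquivalence }

  open SetoidReasoning setoid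

  -- By SN1 and SN2, x ≈ (x ∧ x) ∨ (x ∧ x), so SN1 also gives (x ∧ x) ∧ x ≈ x ∧ x.
  ∧-idem : Idempotent _≈_ _∧_
  ∧-idem x = begin
    x ∧ x                          ≈⟨ ∧-cong refl doubled ⟩
    x ∧ ((x ∧ x) ∨ (x ∧ x))        ≈⟨ SN2 x (x ∧ x) (x ∧ x) ⟩
    ((x ∧ x) ∧ x) ∨ ((x ∧ x) ∧ x)  ≈⟨ ∨-cong absorbed absorbed ⟩
    (x ∧ x) ∨ (x ∧ x)              ≈⟨ doubled ⟨
    x                              ∎
    where
    doubled : x ≈ (x ∧ x) ∨ (x ∧ x)
    doubled = trans (sym (SN1 x x)) (SN2 x x x)

    absorbed : (x ∧ x) ∧ x ≈ x ∧ x
    absorbed = trans (∧-cong refl doubled) (SN1 (x ∧ x) (x ∧ x))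

  ∨-idem : Idempotent _≈_ _∨_
  ∨-idem x = begin
    x ∨ x              ≈⟨ ∨-cong (∧-idem x) (∧-idem x) ⟨
    (x ∧ x) ∨ (x ∧ x)  ≈⟨ SN2 x x x ⟨
    x ∧ (x ∨ x)        ≈⟨ SN1 x x ⟩
    x                  ∎

  -- SN2 swaps the factors as it distributes, so distributing `x` over `y ∨ y` commutes the meet
  -- once both joins collapse.
  ∧-comm : Commutative _≈_ _∧_
  ∧-comm x y = begin
    x ∧ y              ≈⟨ ∧-cong refl (∨-idem y) ⟨
    x ∧ (y ∨ y)        ≈⟨ SN2 x y y ⟩
    (y ∧ x) ∨ (y ∧ x)  ≈⟨ ∨-idem (y ∧ x) ⟩
    y ∧ x              ∎

  ∨-comm : Commutative _≈_ _∨_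
  ∨-comm x y = begin
    x ∨ y              ≈⟨ ∨-cong (SN3 x) (SN3 y) ⟨
    ∼ ∼ x ∨ ∼ ∼ y      ≈⟨ SN4 (∼ x) (∼ y) ⟨
    ∼ (∼ x ∧ ∼ y)      ≈⟨ ∼-cong (∧-comm (∼ x) (∼ y)) ⟩
    ∼ (∼ y ∧ ∼ x)      ≈⟨ SN4 (∼ y) (∼ x) ⟩
    ∼ ∼ y ∨ ∼ ∼ x      ≈⟨ ∨-cong (SN3 y) (SN3 x) ⟩
    y ∨ x              ∎

  ∧-∨-absorbs : ∀ x y → (y ∧ x) ∨ x ≈ x
  ∧-∨-absorbs x y = begin
    (y ∧ x) ∨ x        ≈⟨ ∨-cong refl (∧-idem x) ⟨
    (y ∧ x) ∨ (x ∧ x)  ≈⟨ SN2 x x y ⟨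
    x ∧ (x ∨ y)        ≈⟨ SN1 x y ⟩
    x                  ∎

  -- The order `x ≤ y` is encoded as `x ∧ y ≈ x` here and below.
  ≤⇒∨ : ∀ {x y} → x ∧ y ≈ x → x ∨ y ≈ y
  ≤⇒∨ {x} {y} x≤y = trans (∨-cong (sym x≤y) refl) (∧-∨-absorbs y x)

  -- Distributing `x` over `y ∨ z ≈ z` takes the place of an appeal to associativity of `∧`.
  ≤-trans : ∀ {x y z} → x ∧ y ≈ x → y ∧ z ≈ y → x ∧ z ≈ x
  ≤-trans {x} {y} {z} x≤y y≤z = begin
    x ∧ z              ≈⟨ ∧-cong refl (≤⇒∨ y≤z) ⟨
    x ∧ (y ∨ z)        ≈⟨ SN2 x y z ⟩
    (z ∧ x) ∨ (y ∧ x)  ≈⟨ ∨-cong refl (trans (∧-comm y x) x≤y) ⟩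
    (z ∧ x) ∨ x        ≈⟨ ∧-∨-absorbs x z ⟩
    x                  ∎

  ⇒N-cong : ∀ {x y u v} → x ≈ y → u ≈ v → x ⇒N u ≈ y ⇒N v
  ⇒N-cong x≈y u≈v = ⇒-cong x≈y (∧-cong x≈y u≈v)

  ⇒N-self : ∀ x → x ⇒N x ≈ x ⇒ x
  ⇒N-self x = ⇒-cong refl (∧-idem x)

  -- SN6 with both arguments equal reduces the claim to the absorption law SN1.
  x≤x⇒x : ∀ x → x ∧ (x ⇒ x) ≈ x
  x≤x⇒x x = begin
    x ∧ (x ⇒ x)   ≈⟨ ∧-cong refl (⇒N-self x) ⟨
    x ∧ (x ⇒N x)  ≈⟨ SN6 x x ⟩
    x ∧ (∼ x ∨ x) ≈⟨ ∧-cong refl (∨-comm (∼ x) x) ⟩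
    x ∧ (x ∨ ∼ x) ≈⟨ SN1 x (∼ x) ⟩
    x             ∎

  -- With all three variables equal, SN8 is a nest of `⇒N` whose every entry is `x ⇒ x`; SN7 and
  -- idempotence of `∧` merge the repeated antecedents.
  ⇒-self-self : ∀ x → (x ⇒ x) ⇒ (x ⇒ x) ≈ 𝟏
  ⇒-self-self x = begin
    e ⇒ e                                ≈⟨ ⇒N-self e ⟨
    e ⇒N e                               ≈⟨ contract ⟨
    e ⇒N (e ⇒N e)                        ≈⟨ contract ⟨
    e ⇒N (e ⇒N (e ⇒N e))                 ≈⟨ ⇒N-cong (⇒N-self x) (⇒N-cong (⇒N-self x) refl) ⟨
    (x ⇒N x) ⇒N ((x ⇒N x) ⇒N (e ⇒N e))  ≈⟨ SN8 x x x ⟩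
    𝟏                                    ∎
    where
    e : Carrier
    e = x ⇒ x

    contract : ∀ {y z} → y ⇒N (y ⇒N z) ≈ y ⇒N z
    contract {y} {z} = trans (SN7 y y z) (⇒N-cong (∧-idem y) refl)

  -- Chains `x ≤ e ≤ e ⇒ e ≈ 𝟏` for `e = x ⇒ x`, so `𝟏` is the greatest element.
  ∧-identityʳ : RightIdentity _≈_ 𝟏 _∧_
  ∧-identityʳ x = ≤-trans (x≤x⇒x x)
    (trans (∧-cong refl (sym (⇒-self-self x))) (x≤x⇒x (x ⇒ x)))

  -- De Morgan dual of `𝟏` being the greatest element.
  ∼𝟏-zeroˡ : LeftZero _≈_ (∼ 𝟏) _∧_
  ∼𝟏-zeroˡ x = begin
    ∼ 𝟏 ∧ x              ≈⟨ SN3 (∼ 𝟏 ∧ x) ⟨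
    ∼ ∼ (∼ 𝟏 ∧ x)        ≈⟨ ∼-cong (SN4 (∼ 𝟏) x) ⟩
    ∼ (∼ ∼ 𝟏 ∨ ∼ x)      ≈⟨ ∼-cong (∨-cong (SN3 𝟏) refl) ⟩
    ∼ (𝟏 ∨ ∼ x)          ≈⟨ ∼-cong (∨-comm 𝟏 (∼ x)) ⟩
    ∼ (∼ x ∨ 𝟏)          ≈⟨ ∼-cong (≤⇒∨ (∧-identityʳ (∼ x))) ⟩
    ∼ 𝟏                  ∎

  ⇒∼𝟏≈𝟏→x≤∼x : ∀ x → x ⇒ ∼ 𝟏 ≈ 𝟏 → x ∧ ∼ x ≈ x
  ⇒∼𝟏≈𝟏→x≤∼x x x⇒∼𝟏≈𝟏 = begin
    -- Inserting `𝟏` lets SN4 produce the join on the right of SN6.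
    x ∧ ∼ x           ≈⟨ ∧-cong refl (∼-cong (∧-identityʳ x)) ⟨
    x ∧ ∼ (x ∧ 𝟏)     ≈⟨ ∧-cong refl (SN4 x 𝟏) ⟩
    x ∧ (∼ x ∨ ∼ 𝟏)   ≈⟨ SN6 x (∼ 𝟏) ⟨
    -- Since `x ∧ ∼ 𝟏 ≈ ∼ 𝟏`, here `⇒N` agrees with `⇒` and the hypothesis applies.
    x ∧ (x ⇒N ∼ 𝟏)    ≈⟨ ∧-cong refl (⇒-cong refl (trans (∧-comm x (∼ 𝟏)) (∼𝟏-zeroˡ x))) ⟩
    x ∧ (x ⇒ ∼ 𝟏)     ≈⟨ ∧-cong refl x⇒∼𝟏≈𝟏 ⟩
    x ∧ 𝟏             ≈⟨ ∧-identityʳ x ⟩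
    x                 ∎

proposition4p5 : ∀ {a ℓ : Level} (A : DuallyHemimorphicSemiNelsonAlgebra a ℓ) →
    let open DuallyHemimorphicSemiNelsonAlgebra A in
    Centered × IsCenter (𝟏 ′)
proposition4p5 A = (𝟏 ′ , center) , center
  where
  open DuallyHemimorphicSemiNelsonAlgebra A
  open SemiNelsonProperties semiNelsonAlgebra
  open SetoidReasoning setoid

  center : IsCenter (𝟏 ′)
  -- Antisymmetry: each side equals the meet of `𝟏 ′` and `∼ 𝟏 ′`, so commutativity of `∧` joins the
  -- two inequalities.
  center = begin
    ∼ 𝟏 ′            ≈⟨ ⇒∼𝟏≈𝟏→x≤∼x (∼ 𝟏 ′)
                          (trans (⇒-cong refl (sym (∼𝟏-zeroˡ (𝟏 ′ ⇒ 𝟏)))) (DSN4 𝟏)) ⟨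
    ∼ 𝟏 ′ ∧ ∼ ∼ 𝟏 ′  ≈⟨ ∧-cong refl (SN3 (𝟏 ′)) ⟩
    ∼ 𝟏 ′ ∧ 𝟏 ′      ≈⟨ ∧-comm (∼ 𝟏 ′) (𝟏 ′) ⟩
    𝟏 ′ ∧ ∼ 𝟏 ′      ≈⟨ ⇒∼𝟏≈𝟏→x≤∼x (𝟏 ′) DSN2 ⟩
    𝟏 ′              ∎
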